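{- Let $T$ be a tree of order $n\geq 3$. Then $\mathrm{sd}_{\gamma_t}(T)=1$ if and only if $T$ has (i) a leaf which does not belong to any $\gamma_t(T)$-set, or (ii) an inner edge $uv$ such that for every $\gamma_t(T)$-set $D$: (1) if $|\{u,v\}\cap D|=1$, say $u\in D$, then $v\in PN_T[u,D]$; and (2) if $|\{u,v\}\cap D|=2$, then $N_T(u)\cap D=\{v\}$ or $N_T(v)\cap D=\{u\}$; moreover, if $N_T(u)\cap D=\{v\}$, then $PN_T[u,D]\neq\emptyset$ and ($PN_T[v,D]\neq\emptyset$ or $N_T(x)\cap D=\{v\}$ for some vertex $x\in(N_T(v)\cap D)\setminus\{u\}$), and symmetrically, if $N_T(v)\cap D=\{u\}$, then $PN_T[v,D]\neq\emptyset$ and ($PN_T[u,D]\neq\emptyset$ or $N_T(x)\cap D=\{u\}$ for some vertex $x\in(N_T(u)\cap D)\setminus\{v\}$).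
   Context: A set $S\subseteq V(G)$ is a total dominating set of $G$ if every vertex of $G$ is adjacent to a vertex of $S$; $\gamma_t(G)$ is the minimum size of such a set and a $\gamma_t(G)$-set is a total dominating set of that size. A leaf is a vertex of degree 1; an inner edge is an edge not incident with a leaf. $N_T(v)$ is the open neighbourhood and $N_T[v]=N_T(v)\cup\{v\}$; for $X\subseteq V$, $N_T[X]=\bigcup_{x\in X}N_T[x]$. For $u\in D\subseteq V(T)$, $PN_T[u,D]=N_T[u]\setminus N_T[D\setminus\{u\}]$. $\mathrm{sd}_{\gamma_t}(G)$ is the minimum number of edges that must be subdivided (each edge at most once, i.e. replaced by a path of length 2 through a new vertex) to increase $\gamma_t$. -}

module Defs where

open import Level using (0ℓ)
open import Data.Nat using (ℕ; _≤_; _<_; _+_)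
open import Data.Fin using (Fin; toℕ; splitAt)
open import Data.Fin.Subset using (Subset; _∈_; _∉_; ∣_∣)
open import Data.List using (List; []; _∷_; _++_; length; lookup)
open import Data.List.Relation.Unary.All using (All)
open import Data.List.Relation.Unary.Linked using (Linked)
open import Data.List.Relation.Unary.Unique.Propositional using (Unique)
import Data.List.Membership.Propositional as LM
open import Data.Product using (Σ; ∃; _×_; _,_; proj₁; proj₂)
open import Data.Sum using (_⊎_; inj₁; inj₂)
open import Data.Empty using (⊥)
open import Relation.Nullary using (¬_)
open import Relation.Binary.PropositionalEquality using (_≡_; _≢_)

record Graph (n : ℕ) : Set₁ where
  field
    Adj    : Fin n → Fin n → Set
    sym    : ∀ {u v} → Adj u v → Adj v u
    irrefl : ∀ {u} → ¬ Adj u u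
open Graph public

AdjRel : ℕ → Set₁
AdjRel n = Fin n → Fin n → Set

data Walk {n : ℕ} (A : AdjRel n) : Fin n → Fin n → Set where
  here  : ∀ {u} → Walk A u u
  there : ∀ {u w v} → A u w → Walk A w v → Walk A u v

Connected : ∀ {n} → AdjRel n → Set
Connected A = ∀ u v → Walk A u v

HasCycle : ∀ {n} → AdjRel n → Set
HasCycle {n} A = Σ (Fin n) λ v → Σ (List (Fin n)) λ vs →
  (2 ≤ length vs) × Unique (v ∷ vs) × Linked A (v ∷ (vs ++ v ∷ []))

IsTree : ∀ {n} → Graph n → Set
IsTree G = Connected (Adj G) × ¬ HasCycle (Adj G)

IsTDS : ∀ {n} → AdjRel n → Subset n → Set
IsTDS A S = ∀ v → ∃ λ u → u ∈ S × A v u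

IsγtSet : ∀ {n} → AdjRel n → Subset n → Set
IsγtSet A S = IsTDS A S × (∀ S' → IsTDS A S' → ∣ S ∣ ≤ ∣ S' ∣)

Γt : ∀ {n} → AdjRel n → ℕ → Set
Γt A k = (∃ λ S → IsTDS A S × ∣ S ∣ ≡ k) × (∀ S → IsTDS A S → k ≤ ∣ S ∣)

-- Subdivision of a set of edges.
-- A set of edges is a duplicate-free list of pairs (a , b) with a adjacent
-- to b and toℕ a < toℕ b (canonical representation of the unordered edge).

ValidEdgeSet : ∀ {n} → Graph n → List (Fin n × Fin n) → Set
ValidEdgeSet G F =
  All (λ e → Adj G (proj₁ e) (proj₂ e) × toℕ (proj₁ e) < toℕ (proj₂ e)) F
  × Unique F

-- Vertices of the subdivided graph: old vertices (inj₁) and one new vertex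
-- per subdivided edge (inj₂ k for the k-th edge of F).
subAdj' : ∀ {n} → Graph n → (F : List (Fin n × Fin n)) →
          Fin n ⊎ Fin (length F) → Fin n ⊎ Fin (length F) → Set
subAdj' G F (inj₁ i) (inj₁ j) =
  Adj G i j × ¬ ((i , j) LM.∈ F) × ¬ ((j , i) LM.∈ F)
subAdj' G F (inj₁ i) (inj₂ k) = i ≡ proj₁ (lookup F k) ⊎ i ≡ proj₂ (lookup F k)
subAdj' G F (inj₂ k) (inj₁ i) = i ≡ proj₁ (lookup F k) ⊎ i ≡ proj₂ (lookup F k)
subAdj' G F (inj₂ k) (inj₂ l) = ⊥

Subdivide : ∀ {n} → Graph n → (F : List (Fin n × Fin n)) → AdjRel (n + length F)
Subdivide {n} G F x y = subAdj' G F (splitAt n x) (splitAt n y)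

Increases : ∀ {n} → Graph n → List (Fin n × Fin n) → Set
Increases G F = ∃ λ a → ∃ λ b → Γt (Adj G) a × Γt (Subdivide G F) b × a < b

SdγtEq : ∀ {n} → Graph n → ℕ → Set
SdγtEq {n} G k =
  (Σ (List (Fin n × Fin n)) λ F → ValidEdgeSet G F × length F ≡ k × Increases G F)
  × (∀ F → ValidEdgeSet G F → Increases G F → k ≤ length F)

IsLeaf : ∀ {n} → Graph n → Fin n → Set
IsLeaf G v = ∃ λ u → Adj G v u × (∀ w → Adj G v w → w ≡ u)

IsInnerEdge : ∀ {n} → Graph n → Fin n → Fin n → Set
IsInnerEdge G u v = Adj G u v × ¬ IsLeaf G u × ¬ IsLeaf G v

InClosedNbhd : ∀ {n} → Graph n → Fin n → Fin n → Set
InClosedNbhd G u w = w ≡ u ⊎ Adj G u w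

InPN : ∀ {n} → Graph n → Fin n → Subset n → Fin n → Set
InPN G u D w = InClosedNbhd G u w ×
  (∀ x → x ∈ D → x ≢ u → ¬ InClosedNbhd G x w)

PNNonempty : ∀ {n} → Graph n → Fin n → Subset n → Set
PNNonempty G u D = ∃ λ w → InPN G u D w

NbhdInterEq : ∀ {n} → Graph n → Fin n → Subset n → Fin n → Set
NbhdInterEq G u D v = ∀ w → ((Adj G u w × w ∈ D) → w ≡ v) × (w ≡ v → Adj G u w × w ∈ D)

EdgeCondition : ∀ {n} → Graph n → Fin n → Fin n → Subset n → Set
EdgeCondition G u v D =
  ((u ∈ D → v ∉ D → InPN G u D v) × (v ∈ D → u ∉ D → InPN G v D u))
  × (u ∈ D → v ∈ D →
       (NbhdInterEq G u D v ⊎ NbhdInterEq G v D u)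
       × (NbhdInterEq G u D v →
            PNNonempty G u D ×
            (PNNonempty G v D ⊎
              (∃ λ x → Adj G v x × x ∈ D × x ≢ u × NbhdInterEq G x D v)))
       × (NbhdInterEq G v D u →
            PNNonempty G v D ×
            (PNNonempty G u D ⊎
              (∃ λ x → Adj G u x × x ∈ D × x ≢ v × NbhdInterEq G x D u))))

{-# OPTIONS --safe #-}
-- Subdividing an edge uv by a new vertex w leaves γt unchanged exactly when some γt-set D can be
-- turned into an equally large total dominating set of the subdivided tree. Such a set S either
-- avoids w, and then S itself is a γt-set containing u or v, or it contains w and, up to symmetry,
-- u, and then exchanging w for v yields a γt-set containing both u and v. Reading the
-- domination of S back in terms of D gives, case by case, the negation of the edge condition.
-- If v is a leaf, a γt-set containing v exists precisely when the exchange is possible.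
module Submission where

open import Defs
open import Data.Nat using (ℕ; suc; _+_; _≤_; _<_; s≤s; z≤n; _≤?_; _<?_)
open import Data.Nat.Properties
  using (≤-refl; ≤-trans; ≤-reflexive; n≤1+n; <-≤-trans; ≤-<-trans; <-irrefl; ≮⇒≥; ≰⇒>; +-comm; <-cmp)
open import Data.Nat.Induction using (<-wellFounded)
open import Induction.WellFounded using (Acc; acc)
open import Data.Fin using (Fin; zero; suc; toℕ; splitAt; join; _≟_)
open import Data.Fin.Properties using (any?; all?; splitAt-join; toℕ-injective)
open import Data.Fin.Subset using (Subset; Side; inside; outside; _∈_; _∉_; ∣_∣; _-_; _∪_; ⁅_⁆; ⊤)
open import Data.Fin.Subset.Properties
  using (_∈?_; anySubset?; x∈p∧x≢y⇒x∈p-y; x∈p⇒∣p-x∣<∣p∣; ∪-identityʳ; x∈⁅x⁆; x∈⁅y⁆⇒x≡y;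
         p⊆q⇒∣p∣≤∣q∣; x∈p∪q⁺; x∈p∪q⁻; ∈⊤)
open import Data.Vec using ([]; _∷_; _++_; lookup; here)
  renaming (splitAt to splitVec)
open import Data.Vec.Properties using (lookup-splitAt; lookup⇒[]=; []=⇒lookup)
open import Data.List using (List; []; _∷_; length)
  renaming (_++_ to _++ˡ_; lookup to lookupˡ)
open import Data.List.Relation.Unary.All using ([]; _∷_)
open import Data.List.Relation.Unary.All.Properties using (¬Any⇒All¬)
open import Data.List.Relation.Unary.Any using () renaming (here to hereˡ; there to thereˡ)
open import Data.List.Relation.Unary.AllPairs using ([]; _∷_)
open import Data.List.Relation.Unary.Linked using (Linked; [-]; _∷_)
open import Data.List.Relation.Unary.Unique.Propositional using (Unique)
import Data.List.Membership.Propositional as LM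
import Data.List.Membership.DecPropositional as DecMembership
open import Data.Product using (∃; _×_; _,_; proj₁; proj₂)
open import Data.Product.Properties using (≡-dec)
open import Data.Sum using (_⊎_; inj₁; inj₂; [_,_]′; swap)
open import Data.Empty using (⊥; ⊥-elim)
open import Function.Base using (_∘_)
open import Function.Bundles using (_⇔_; mk⇔)
open import Relation.Binary.Definitions using (tri<; tri≈; tri>)
open import Relation.Binary.PropositionalEquality
  using (_≡_; _≢_; refl; trans; cong; subst) renaming (sym to ≡-sym)
open import Relation.Nullary using (¬_; Dec; yes; no)
open import Relation.Nullary.Decidable
  using (_×-dec_; _⊎-dec_; _→-dec_; ¬?; decidable-stable)

-- Simple paths and decidable adjacency in trees.

data Path {n : ℕ} (A : AdjRel n) : Fin n → List (Fin n) → Fin n → Set where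
  stop : ∀ {u} → Path A u [] u
  step : ∀ {u w v vs} → A u w → Path A w vs v → Path A u (w ∷ vs) v

close : ∀ {n} {A : AdjRel n} {u v t vs} → Path A u vs v → A v t → Linked A (u ∷ (vs ++ˡ t ∷ []))
close stop       e = e ∷ [-]
close (step a p) e = a ∷ close p e

SimplePath : ∀ {n} → AdjRel n → Fin n → Fin n → Set
SimplePath A u v = ∃ λ vs → Path A u vs v × Unique (u ∷ vs)

from-member : ∀ {n} {A : AdjRel n} {w v vs x} → Path A w vs v → Unique (w ∷ vs) →
              x LM.∈ (w ∷ vs) → SimplePath A x v
from-member p          uq       (hereˡ refl) = _ , p , uq
from-member (step _ p) (_ ∷ uq) (thereˡ m)   = from-member p uq m

-- Loop erasure: if the new first vertex already occurs on the simple path built so far, that path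
-- is cut down to its part from this occurrence on.
walk⇒simplePath : ∀ {n} {A : AdjRel n} {u v} → Walk A u v → SimplePath A u v
walk⇒simplePath here = [] , stop , [] ∷ []
walk⇒simplePath {u = u} (there {w = w} a k) with walk⇒simplePath k
... | vs , p , uq with DecMembership._∈?_ _≟_ u (w ∷ vs)
...   | yes m = from-member p uq m
...   | no ¬m = _ , step a p , ¬Any⇒All¬ _ ¬m ∷ uq

-- In a tree, u and v are adjacent iff a simple path between them has length one: an edge closing
-- a longer one would create a cycle.
tree-adj? : ∀ {n} (G : Graph n) → IsTree G → ∀ u v → Dec (Adj G u v)
tree-adj? G (conn , acyclic) u v with walk⇒simplePath (conn u v)
... | _ , stop                , _  = no (irrefl G)
... | _ , step a stop         , _  = yes a
... | _ , step a (step b p)   , uq =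
  no λ e → acyclic (_ , _ , s≤s (s≤s z≤n) , uq , close (step a (step b p)) (sym G e))

-- The first edge of a walk to any other vertex. Without isolated vertices the full vertex set is
-- total dominating, so a minimum exists.
neighbour : ∀ {n} (G : Graph n) → IsTree G → 3 ≤ n → ∀ v → ∃ (Adj G v)
neighbour G (conn , _) (s≤s (s≤s (s≤s _))) v = go v
  where
  first : ∀ {x y} → x ≢ y → Walk (Adj G) x y → ∃ (Adj G x)
  first x≢y here        = ⊥-elim (x≢y refl)
  first _   (there a _) = _ , a
  go : ∀ v → ∃ (Adj G v)
  go zero    = first (λ ()) (conn zero (suc zero))
  go (suc i) = first (λ ()) (conn (suc i) zero)

leaf? : ∀ {n} (G : Graph n) → (∀ u v → Dec (Adj G u v)) → ∀ v → Dec (IsLeaf G v)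
leaf? G adj? v = any? λ u → adj? v u ×-dec all? λ w → adj? v w →-dec (w ≟ u)

-- Subset sizes and the existence of minimum total dominating sets.

∣p∪⁅x⁆∣≤1+∣p∣ : ∀ {n} (p : Subset n) x → ∣ p ∪ ⁅ x ⁆ ∣ ≤ suc ∣ p ∣
∣p∪⁅x⁆∣≤1+∣p∣ (inside ∷ p)  zero    rewrite ∪-identityʳ p = n≤1+n _
∣p∪⁅x⁆∣≤1+∣p∣ (outside ∷ p) zero    rewrite ∪-identityʳ p = ≤-refl
∣p∪⁅x⁆∣≤1+∣p∣ (inside ∷ p)  (suc x) = s≤s (∣p∪⁅x⁆∣≤1+∣p∣ p x)
∣p∪⁅x⁆∣≤1+∣p∣ (outside ∷ p) (suc x) = ∣p∪⁅x⁆∣≤1+∣p∣ p x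

-- Descent on size: whether a smaller subset satisfies `P` is decidable, and a negative answer
-- certifies minimality.
minimal-subset : ∀ {m} {P : Subset m → Set} → (∀ S → Dec (P S)) → ∃ P →
                 ∃ λ S → P S × (∀ S' → P S' → ∣ S ∣ ≤ ∣ S' ∣)
minimal-subset {P = P} P? (S , pS) = go S pS (<-wellFounded ∣ S ∣)
  where
  go : ∀ S → P S → Acc _<_ ∣ S ∣ → ∃ λ S → P S × (∀ S' → P S' → ∣ S ∣ ≤ ∣ S' ∣)
  go S pS (acc rec) with anySubset? (λ S' → P? S' ×-dec (∣ S' ∣ <? ∣ S ∣))
  ... | yes (S' , pS' , S'<S) = go S' pS' (rec S'<S)
  ... | no  none              = S , pS , λ S' pS' → ≮⇒≥ λ S'<S → none (S' , pS' , S'<S)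

tds? : ∀ {n} {A : AdjRel n} → (∀ u v → Dec (A u v)) → ∀ S → Dec (IsTDS A S)
tds? A? S = all? λ v → any? λ u → (u ∈? S) ×-dec A? v u

γtSet-exists : ∀ {n} {A : AdjRel n} → (∀ u v → Dec (A u v)) → (∀ v → ∃ (A v)) → ∃ (IsγtSet A)
γtSet-exists A? nbr = minimal-subset (tds? A?) (⊤ , λ v → proj₁ (nbr v) , ∈⊤ , proj₂ (nbr v))

γtSet⇒Γt : ∀ {n} {A : AdjRel n} {S} → IsγtSet A S → Γt A ∣ S ∣
γtSet⇒Γt (tds , min) = (_ , tds , refl) , min

-- Subsets of the subdivided vertex set

Member : ∀ {n m} → Subset n → Subset m → Fin n ⊎ Fin m → Set
Member D E = [ _∈ D , _∈ E ]′

∈-++⁻ : ∀ {n m} (D : Subset n) (E : Subset m) {x} → x ∈ D ++ E → Member D E (splitAt n x)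
∈-++⁻ {n} D E {x} x∈ = go (splitAt n x) (trans (≡-sym (lookup-splitAt n D E x)) ([]=⇒lookup x∈))
  where
  go : ∀ s → [ lookup D , lookup E ]′ s ≡ inside → Member D E s
  go (inj₁ i) eq = lookup⇒[]= i D eq
  go (inj₂ k) eq = lookup⇒[]= k E eq

∈-++⁺ : ∀ {n m} (D : Subset n) (E : Subset m) {x} → Member D E (splitAt n x) → x ∈ D ++ E
∈-++⁺ {n} D E {x} m = lookup⇒[]= x (D ++ E) (trans (lookup-splitAt n D E x) (go (splitAt n x) m))
  where
  go : ∀ s → Member D E s → [ lookup D , lookup E ]′ s ≡ inside
  go (inj₁ i) = []=⇒lookup
  go (inj₂ k) = []=⇒lookup

-- Total domination over the disjoint union of old and new vertices, so that case splits meet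
-- constructors instead of `splitAt`.
Dominates : ∀ {n} (G : Graph n) F → Subset n → Subset (length F) → Set
Dominates G F D E = ∀ x → ∃ λ y → Member D E y × subAdj' G F x y

tds⇒dominates : ∀ {n} (G : Graph n) F D E → IsTDS (Subdivide G F) (D ++ E) → Dominates G F D E
tds⇒dominates {n} G F D E tds x with tds (join n (length F) x)
... | y , y∈ , adj = splitAt n y , ∈-++⁻ D E y∈ ,
  subst (λ z → subAdj' G F z (splitAt n y)) (splitAt-join n (length F) x) adj

dominates⇒tds : ∀ {n} (G : Graph n) F D E → Dominates G F D E → IsTDS (Subdivide G F) (D ++ E)
dominates⇒tds {n} G F D E dom x with dom (splitAt n x)
... | y , y∈ , adj = join n (length F) y ,
  ∈-++⁺ D E (subst (Member D E) (≡-sym (splitAt-join n (length F) y)) y∈) ,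
  subst (subAdj' G F (splitAt n x)) (≡-sym (splitAt-join n (length F) y)) adj

∣D++E∣ : ∀ {n m} (D : Subset n) (E : Subset m) → ∣ D ++ E ∣ ≡ ∣ D ∣ + ∣ E ∣
∣D++E∣ []            E = refl
∣D++E∣ (inside ∷ D)  E = cong suc (∣D++E∣ D E)
∣D++E∣ (outside ∷ D) E = ∣D++E∣ D E

∣D++[w]∣ : ∀ {n} (D : Subset n) w → ∣ D ++ w ∷ [] ∣ ≡ ∣ w ∷ D ∣
∣D++[w]∣ D inside  = trans (∣D++E∣ D _) (+-comm ∣ D ∣ 1)
∣D++[w]∣ D outside = trans (∣D++E∣ D _) (+-comm ∣ D ∣ 0)

subdivide? : ∀ {n} (G : Graph n) → (∀ u v → Dec (Adj G u v)) → ∀ F x y → Dec (Subdivide G F x y)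
subdivide? {n} G adj? F x y = go (splitAt n x) (splitAt n y)
  where
  open DecMembership (≡-dec {B = λ _ → Fin n} _≟_ _≟_) using () renaming (_∈?_ to _∈ˡ?_)
  go : ∀ s t → Dec (subAdj' G F s t)
  go (inj₁ i) (inj₁ j) = adj? i j ×-dec (¬? ((i , j) ∈ˡ? F) ×-dec ¬? ((j , i) ∈ˡ? F))
  go (inj₁ i) (inj₂ k) = (i ≟ proj₁ (lookupˡ F k)) ⊎-dec (i ≟ proj₂ (lookupˡ F k))
  go (inj₂ k) (inj₁ i) = (i ≟ proj₁ (lookupˡ F k)) ⊎-dec (i ≟ proj₂ (lookupˡ F k))
  go (inj₂ k) (inj₂ l) = no λ ()

-- This gives the lower bound in `SdγtEq G 1`: with no edge subdivided, a minimum set of `G` still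
-- dominates.
¬increases-[] : ∀ {n} (G : Graph n) → ¬ Increases G []
¬increases-[] G (_ , _ , ((S , tds , refl) , _) , (_ , min) , a<b) =
  <-irrefl refl (<-≤-trans a<b (≤-trans (min (S ++ []) tds') (≤-reflexive size)))
  where
  tds' = dominates⇒tds G [] S [] λ where
    (inj₁ i) → let u , u∈ , a = tds i in inj₁ u , u∈ , a , (λ ()) , (λ ())
  size = trans (∣D++E∣ S []) (+-comm ∣ S ∣ 0)

-- Subdividing a single edge

-- The pair D, w encodes the subset of the subdivided vertex set whose old vertices are D and
-- which contains the new vertex iff w is inside; its size is that of w ∷ D.

module _ {n : ℕ} (G : Graph n) where

  Kept : Fin n → Fin n → Fin n → Fin n → Set
  Kept a b i j = Adj G i j × ¬ (i ≡ a × j ≡ b) × ¬ (i ≡ b × j ≡ a)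

  SubDominated : Fin n → Fin n → Side → Subset n → Fin n → Set
  SubDominated a b w D i = (∃ λ j → j ∈ D × Kept a b i j) ⊎ (w ≡ inside × (i ≡ a ⊎ i ≡ b))

  -- The second component is the domination of the new vertex, whose only neighbours are `a` and
  -- `b`.
  SubTDS : Fin n → Fin n → Side → Subset n → Set
  SubTDS a b w D = (∀ i → SubDominated a b w D i) × (a ∈ D ⊎ b ∈ D)

  -- The content of `Increases` for one edge, but symmetric in `a` and `b` and free of `splitAt`.
  -- Everything below passes through it.
  Costly : Fin n → Fin n → Set
  Costly a b = ∀ D₀ → IsγtSet (Adj G) D₀ → ∀ w D → SubTDS a b w D → ∣ D₀ ∣ < ∣ w ∷ D ∣

  subTDS-swap : ∀ {a b w D} → SubTDS a b w D → SubTDS b a w D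
  subTDS-swap {a} {b} {w} {D} (dom , new) = (λ i → flip (dom i)) , swap new
    where
    flip : ∀ {i} → SubDominated a b w D i → SubDominated b a w D i
    flip (inj₁ (j , j∈ , e , c , c')) = inj₁ (j , j∈ , e , c' , c)
    flip (inj₂ (w≡ , i≡))             = inj₂ (w≡ , swap i≡)

  costly-swap : ∀ {a b} → Costly a b → Costly b a
  costly-swap costly D₀ γ w D = costly D₀ γ w D ∘ subTDS-swap

  subTDS⇒dominates : ∀ {a b w D} → SubTDS a b w D → Dominates G ((a , b) ∷ []) D (w ∷ [])
  subTDS⇒dominates (dom , _) (inj₁ i) with dom i
  ... | inj₁ (j , j∈ , e , c , c') = inj₁ j , j∈ , e ,
    (λ { (hereˡ refl) → c (refl , refl) }) , (λ { (hereˡ refl) → c' (refl , refl) })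
  ... | inj₂ (refl , i≡) = inj₂ zero , here , i≡
  subTDS⇒dominates (_ , inj₁ a∈) (inj₂ zero) = inj₁ _ , a∈ , inj₁ refl
  subTDS⇒dominates (_ , inj₂ b∈) (inj₂ zero) = inj₁ _ , b∈ , inj₂ refl

  dominates⇒subTDS : ∀ {a b w D} → Dominates G ((a , b) ∷ []) D (w ∷ []) → SubTDS a b w D
  dominates⇒subTDS {a} {b} {w} {D} dom = old , new (dom (inj₂ zero))
    where
    old : ∀ i → SubDominated a b w D i
    old i with dom (inj₁ i)
    ... | inj₁ j , j∈ , e , c , c' = inj₁ (j , j∈ , e ,
      (λ { (refl , refl) → c (hereˡ refl) }) , (λ { (refl , refl) → c' (hereˡ refl) }))
    ... | inj₂ zero , here , i≡ = inj₂ (refl , i≡)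
    new : _ → a ∈ D ⊎ b ∈ D
    new (inj₁ _ , j∈ , inj₁ refl) = inj₁ j∈
    new (inj₁ _ , j∈ , inj₂ refl) = inj₂ j∈

  increases⇒costly : ∀ {a b} → Increases G ((a , b) ∷ []) → Costly a b
  increases⇒costly (_ , _ , ((S , tds , refl) , _) , (_ , min) , k<m) D₀ (_ , D₀-min) w D sub =
    ≤-<-trans (D₀-min S tds) (<-≤-trans k<m
      (≤-trans (min (D ++ w ∷ []) (dominates⇒tds G _ D _ (subTDS⇒dominates sub)))
               (≤-reflexive (∣D++[w]∣ D w))))

  -- The full vertex set is total dominating: `a` and `b` see the new vertex, and every other old
  -- vertex keeps all its edges. A dominator of `x` is then a neighbour.
  subdivision-neighbour : (∀ v → ∃ (Adj G v)) → ∀ a b x → ∃ (Subdivide G ((a , b) ∷ []) x)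
  subdivision-neighbour nbr a b x =
    let y , _ , e = dominates⇒tds G _ ⊤ _ (subTDS⇒dominates full) x in y , e
    where
    full : SubTDS a b inside ⊤
    full = old , inj₁ ∈⊤
      where
      old : ∀ i → SubDominated a b inside ⊤ i
      old i with i ≟ a | i ≟ b
      ... | yes i≡a | _       = inj₂ (refl , inj₁ i≡a)
      ... | no  _   | yes i≡b = inj₂ (refl , inj₂ i≡b)
      ... | no  i≢a | no  i≢b =
        inj₁ (proj₁ (nbr i) , ∈⊤ , proj₂ (nbr i) , i≢a ∘ proj₁ , i≢b ∘ proj₁)

  costly⇒increases : (∀ u v → Dec (Adj G u v)) → (∀ v → ∃ (Adj G v)) →
                     ∀ {a b} → Costly a b → Increases G ((a , b) ∷ [])
  costly⇒increases adj? nbr {a} {b} costly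
    with γtSet-exists adj? nbr
       | γtSet-exists (subdivide? G adj? ((a , b) ∷ [])) (subdivision-neighbour nbr a b)
  ... | D₀ , γ | S , γS@(tds , _) with splitVec n S
  ...   | D , w ∷ [] , refl = _ , _ , γtSet⇒Γt γ , γtSet⇒Γt γS ,
    subst (∣ D₀ ∣ <_) (≡-sym (∣D++[w]∣ D w))
      (costly D₀ γ w D (dominates⇒subTDS (tds⇒dominates G _ D _ tds)))

  -- Trading the new vertex for an endpoint and back.

  γtSet-bound : ∀ {D₀ D} → IsγtSet (Adj G) D₀ → IsTDS (Adj G) D → ∣ D ∣ ≤ ∣ D₀ ∣ → IsγtSet (Adj G) D
  γtSet-bound (_ , min) tds D≤D₀ = tds , λ S S-tds → ≤-trans D≤D₀ (min S S-tds)

  subTDS-outside⇒tds : ∀ {a b D} → SubTDS a b outside D → IsTDS (Adj G) D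
  subTDS-outside⇒tds (dom , _) i with dom i
  ... | inj₁ (j , j∈ , e , _) = j , j∈ , e
  ... | inj₂ (() , _)

  -- The new vertex served only `u` and `v` among the old vertices; once `v` takes its place, `u`
  -- and `v` dominate each other.
  new-vertex⇒tds : ∀ {u v D} → Adj G u v → SubTDS u v inside D → u ∈ D → IsTDS (Adj G) (D ∪ ⁅ v ⁆)
  new-vertex⇒tds {v = v} uv (dom , _) u∈ i with dom i
  ... | inj₁ (j , j∈ , e , _) = j , x∈p∪q⁺ (inj₁ j∈) , e
  ... | inj₂ (_ , inj₁ refl)  = v , x∈p∪q⁺ (inj₂ (x∈⁅x⁆ v)) , uv
  ... | inj₂ (_ , inj₂ refl)  = _ , x∈p∪q⁺ (inj₁ u∈) , sym G uv

  -- The reverse trade. The new vertex serves `u` and `v` and is itself served by `v`, so only the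
  -- other neighbours of `u` can lose their dominator; `cover` provides for these.
  replace-by-new : ∀ {u v D} → IsTDS (Adj G) D → v ∈ D → u ≢ v →
    (∀ y → Adj G u y → y ≢ v → ∃ λ x → x ∈ D × x ≢ u × Adj G y x) → SubTDS u v inside (D - u)
  replace-by-new {u} {v} {D} tds v∈ u≢v cover = dom , inj₂ (x∈p∧x≢y⇒x∈p-y v∈ (u≢v ∘ ≡-sym))
    where
    dom : ∀ i → SubDominated u v inside (D - u) i
    dom i with i ≟ u | i ≟ v
    ... | yes i≡u | _       = inj₂ (refl , inj₁ i≡u)
    ... | no  _   | yes i≡v = inj₂ (refl , inj₂ i≡v)
    ... | no  i≢u | no  i≢v with tds i
    ...   | z , z∈ , e with z ≟ u
    ...     | no z≢u   = inj₁ (z , x∈p∧x≢y⇒x∈p-y z∈ z≢u , e , i≢u ∘ proj₁ , i≢v ∘ proj₁)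
    ...     | yes refl with cover i (sym G e) i≢v
    ...       | x , x∈ , x≢u , e' =
      inj₁ (x , x∈p∧x≢y⇒x∈p-y x∈ x≢u , e' , i≢u ∘ proj₁ , i≢v ∘ proj₁)

  -- The trade does not increase the size, which `Costly` forbids.
  ¬replace-by-new : ∀ {u v D} → Costly u v → IsγtSet (Adj G) D → u ∈ D → v ∈ D → u ≢ v →
    ¬ (∀ y → Adj G u y → y ≢ v → ∃ λ x → x ∈ D × x ≢ u × Adj G y x)
  ¬replace-by-new costly γ@(tds , _) u∈ v∈ u≢v cover =
    <-irrefl refl (<-≤-trans (costly _ γ inside _ (replace-by-new tds v∈ u≢v cover))
                             (x∈p⇒∣p-x∣<∣p∣ u∈))

  adj⇒≢ : ∀ {u v} → Adj G u v → u ≢ v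
  adj⇒≢ e refl = irrefl G e

  -- Edges at a leaf.

  costly⇒leaf-avoided : ∀ {v u} → Adj G v u → (∀ w → Adj G v w → w ≡ u) → Costly v u →
                        ∀ D → IsγtSet (Adj G) D → v ∉ D
  costly⇒leaf-avoided {v} {u} e only costly D γ@(tds , _) v∈ with tds v
  ... | x , x∈ , vx with only x vx
  -- To dominate the leaf `v`, `D` must contain `u`; and `v` has no neighbour besides `u`, so the
  -- cover condition is vacuous.
  ...   | refl = ¬replace-by-new costly γ v∈ x∈ (adj⇒≢ e) λ y vy y≢u → ⊥-elim (y≢u (only y vy))

  leaf-avoided⇒costly : ∀ {v u} → Adj G v u → (∀ w → Adj G v w → w ≡ u) →
                        (∀ D → IsγtSet (Adj G) D → v ∉ D) → Costly v u
  leaf-avoided⇒costly {v} e only avoid D₀ γ outside D (dom , _) with dom v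
  -- The only edge at the leaf is the subdivided one, so without the new vertex `v` is undominated.
  ... | inj₁ (j , _ , vj , c , _) = ⊥-elim (c (refl , only j vj))
  ... | inj₂ (() , _)
  leaf-avoided⇒costly {v} {u} e only avoid D₀ γ inside D sub@(_ , new) with suc ∣ D ∣ ≤? ∣ D₀ ∣
  ... | no  ≰  = ≰⇒> ≰
  ... | yes le = ⊥-elim (contains new)
    where
    small : ∀ x → ∣ D ∪ ⁅ x ⁆ ∣ ≤ ∣ D₀ ∣
    small x = ≤-trans (∣p∪⁅x⁆∣≤1+∣p∣ D x) le
    -- Trading the new vertex for the endpoint opposite to the one known to lie in `D` gives a
    -- minimum set containing the leaf in either case.
    contains : v ∈ D ⊎ u ∈ D → ⊥
    contains (inj₁ v∈) = avoid _ (γtSet-bound γ (new-vertex⇒tds e sub v∈) (small u)) (x∈p∪q⁺ (inj₁ v∈))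
    contains (inj₂ u∈) =
      avoid _ (γtSet-bound γ (new-vertex⇒tds (sym G e) (subTDS-swap sub) u∈) (small v))
        (x∈p∪q⁺ (inj₂ (x∈⁅x⁆ v)))

  -- Sufficiency of the edge condition.

  edgeCondition-swap : ∀ {u v D} → EdgeCondition G u v D → EdgeCondition G v u D
  edgeCondition-swap ((p , q) , both) = (q , p) , λ v∈ u∈ →
    let either , l , r = both u∈ v∈ in swap either , r , l

  edgeCondition⇒costly : ∀ {u v} → Adj G u v → (∀ D → IsγtSet (Adj G) D → EdgeCondition G u v D) →
                         Costly u v
  edgeCondition⇒costly {u} {v} uv cond D₀ γ w D sub@(_ , new) with ∣ w ∷ D ∣ ≤? ∣ D₀ ∣
  ... | no  ≰  = ≰⇒> ≰
  -- The new vertex is dominated by `u` or by `v`; by symmetry `u ∈ D` may be assumed.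
  ... | yes le = ⊥-elim ([ contra uv cond sub le
                         , contra (sym G uv) (λ D → edgeCondition-swap ∘ cond D) (subTDS-swap sub) le ]′ new)
    where
    contra : ∀ {u v w} → Adj G u v → (∀ D → IsγtSet (Adj G) D → EdgeCondition G u v D) →
             SubTDS u v w D → ∣ w ∷ D ∣ ≤ ∣ D₀ ∣ → u ∈ D → ⊥
    -- Without the new vertex, `D` is itself a minimum set, and `u` and `v` are dominated by edges
    -- other than `uv`. This contradicts privacy of `v` if `v ∉ D`, and the two singleton
    -- alternatives if `v ∈ D`.
    contra {u} {v} {outside} uv cond sub@(dom , _) le u∈
      with cond D (γtSet-bound γ (subTDS-outside⇒tds sub) le) | v ∈? D
    ... | (pn , _) , _ | no v∉ with dom v
    ...   | inj₁ (x , x∈ , vx , _ , c) =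
      proj₂ (pn u∈ v∉) x x∈ (λ { refl → c (refl , refl) }) (inj₂ (sym G vx))
    ...   | inj₂ (() , _)
    contra {u} {v} {outside} uv cond sub@(dom , _) le u∈
        | _ , both | yes v∈ with proj₁ (both u∈ v∈)
    ...   | inj₁ only with dom u
    ...     | inj₁ (x , x∈ , ux , c , _) = c (refl , proj₁ (only x) (ux , x∈))
    ...     | inj₂ (() , _)
    contra {u} {v} {outside} uv cond sub@(dom , _) le u∈
        | _ , both | yes v∈ | inj₂ only with dom v
    ...     | inj₁ (x , x∈ , vx , _ , c) = c (refl , proj₁ (only x) (vx , x∈))
    ...     | inj₂ (() , _)
    contra {u} {v} {inside} uv cond sub@(dom , _) le u∈ with v ∈? D
    -- Here `D ∪ ⁅ v ⁆` is just `D`, a total dominating set of `G` with fewer vertices than the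
    -- minimum.
    ... | yes v∈ = <-irrefl refl (<-≤-trans le (≤-trans (proj₂ γ _ (new-vertex⇒tds uv sub u∈))
        (p⊆q⇒∣p∣≤∣q∣ λ x∈ → absorb (x∈p∪q⁻ D ⁅ v ⁆ x∈))))
      where
      absorb : ∀ {x} → x ∈ D ⊎ x ∈ ⁅ v ⁆ → x ∈ D
      absorb (inj₁ x∈) = x∈
      absorb (inj₂ x∈) with x∈⁅y⁆⇒x≡y v x∈
      ... | refl = v∈
    -- Trading the new vertex for `v` yields a minimum set containing both endpoints; its clauses on
    -- private neighbours of `v` will fail.
    ... | no v∉ with proj₂ (cond (D ∪ ⁅ v ⁆) (γtSet-bound γ (new-vertex⇒tds uv sub u∈)
                       (≤-trans (∣p∪⁅x⁆∣≤1+∣p∣ D v) le)))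
                     (x∈p∪q⁺ (inj₁ u∈)) (x∈p∪q⁺ (inj₂ (x∈⁅x⁆ v)))
    ...   | either , ifU , ifV = fails either
      where
      -- The new vertex reaches only `u` and `v`, so such a `y` has a dominator in `D`, which
      -- differs from `v` because `v ∉ D`.
      dominator : ∀ y → Adj G v y → y ≢ u → ∃ λ z → z ∈ D × z ≢ v × Adj G y z
      dominator y vy y≢u with dom y
      ... | inj₁ (z , z∈ , yz , _)  = z , z∈ , (λ { refl → v∉ z∈ }) , yz
      ... | inj₂ (_ , inj₁ y≡u)     = ⊥-elim (y≢u y≡u)
      ... | inj₂ (_ , inj₂ refl)    = ⊥-elim (irrefl G vy)
      -- Nothing is private to `v`: `u` covers both `u` and `v`, and `dominator` handles the
      -- remaining neighbours.
      noPN : ¬ PNNonempty G v (D ∪ ⁅ v ⁆)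
      noPN (y , inj₁ refl , private-v) = private-v u (x∈p∪q⁺ (inj₁ u∈)) (adj⇒≢ uv) (inj₂ uv)
      noPN (y , inj₂ vy , private-v) with y ≟ u
      ... | yes refl = private-v u (x∈p∪q⁺ (inj₁ u∈)) (adj⇒≢ uv) (inj₁ refl)
      ... | no  y≢u with dominator y vy y≢u
      ...   | z , z∈ , z≢v , yz = private-v z (x∈p∪q⁺ (inj₁ z∈)) z≢v (inj₂ (sym G yz))
      fails : _ → ⊥
      fails (inj₂ onlyU) = noPN (proj₁ (ifV onlyU))
      fails (inj₁ onlyV) with proj₂ (ifU onlyV)
      ... | inj₁ pn = noPN pn
      ... | inj₂ (x , vx , _ , x≢u , onlyV') with dominator x vx x≢u
      ...   | z , z∈ , z≢v , xz = z≢v (proj₁ (onlyV' z) (xz , x∈p∪q⁺ (inj₁ z∈)))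

  -- Necessity of the edge condition.

  module _ (adj? : ∀ u v → Dec (Adj G u v)) where

    closed? : ∀ u y → Dec (InClosedNbhd G u y)
    closed? u y = (y ≟ u) ⊎-dec adj? u y

    covered? : ∀ u D y → Dec (∃ λ x → x ∈ D × x ≢ u × InClosedNbhd G x y)
    covered? u D y = any? λ x → (x ∈? D) ×-dec (¬? (x ≟ u) ×-dec closed? x y)

    PN-nonempty-or-covered : ∀ u D → PNNonempty G u D ⊎
      (∀ y → InClosedNbhd G u y → ∃ λ x → x ∈ D × x ≢ u × InClosedNbhd G x y)
    PN-nonempty-or-covered u D with any? (λ y → closed? u y ×-dec ¬? (covered? u D y))
    ... | yes (y , y∈ , free) = inj₁ (y , y∈ , λ x x∈ x≢u xy → free (x , x∈ , x≢u , xy))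
    ... | no  none = inj₂ λ y y∈ → decidable-stable (covered? u D y) λ free → none (y , y∈ , free)

    only-or-other : ∀ {u v D} → Adj G u v → v ∈ D →
      NbhdInterEq G u D v ⊎ ∃ λ x → x ∈ D × x ≢ v × Adj G u x
    only-or-other {u} {v} {D} uv v∈
      with any? (λ x → (x ∈? D) ×-dec (¬? (x ≟ v) ×-dec adj? u x))
    ... | yes other = inj₂ other
    ... | no  none  = inj₁ λ w →
      (λ { (uw , w∈) → decidable-stable (w ≟ v) λ w≢v → none (w , w∈ , w≢v , uw) }) ,
      (λ { refl → uv , v∈ })

    -- Private neighbourhoods are closed while total domination is open; for a vertex outside `D`
    -- the two agree.
    closed⇒adj : ∀ {D y x} → y ∉ D → x ∈ D → InClosedNbhd G x y → Adj G y x
    closed⇒adj y∉ x∈ (inj₁ refl) = ⊥-elim (y∉ x∈)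
    closed⇒adj y∉ x∈ (inj₂ xy)   = sym G xy

    -- If a clause fails, the corresponding endpoint can be traded for the new vertex: `u` when it
    -- has no private neighbour, `v` when both alternatives for it fail.
    costly⇒only-condition : ∀ {u v D} → Adj G u v → Costly u v → IsγtSet (Adj G) D →
      u ∈ D → v ∈ D → NbhdInterEq G u D v →
      PNNonempty G u D ×
        (PNNonempty G v D ⊎ ∃ λ x → Adj G v x × x ∈ D × x ≢ u × NbhdInterEq G x D v)
    costly⇒only-condition {u} {v} {D} uv costly γ u∈ v∈ only = pnU , pnV
      where
      pnU : PNNonempty G u D
      pnU with PN-nonempty-or-covered u D
      ... | inj₁ pn = pn
      ... | inj₂ covered = ⊥-elim (¬replace-by-new costly γ u∈ v∈ (adj⇒≢ uv) λ y uy y≢v →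
        -- `v` is the only neighbour of `u` in `D`, so `y` lies outside `D` and its coverer is
        -- adjacent to it.
        let x , x∈ , x≢u , xy = covered y (inj₂ uy)
        in x , x∈ , x≢u , closed⇒adj (λ y∈ → y≢v (proj₁ (only y) (uy , y∈))) x∈ xy)
      pnV : _
      pnV with PN-nonempty-or-covered v D
      ... | inj₁ pn = inj₁ pn
      ... | inj₂ covered = inj₂ (decidable-stable exists? λ none →
        ¬replace-by-new (costly-swap costly) γ v∈ u∈ (adj⇒≢ (sym G uv)) (cover none))
        where
        nbhd? : ∀ x → Dec (NbhdInterEq G x D v)
        nbhd? x = all? λ w → ((adj? x w ×-dec (w ∈? D)) →-dec (w ≟ v))
                             ×-dec ((w ≟ v) →-dec (adj? x w ×-dec (w ∈? D)))
        exists? : Dec (∃ λ x → Adj G v x × x ∈ D × x ≢ u × NbhdInterEq G x D v)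
        exists? = any? λ x → adj? v x ×-dec ((x ∈? D) ×-dec (¬? (x ≟ u) ×-dec nbhd? x))
        cover : ¬ (∃ λ x → Adj G v x × x ∈ D × x ≢ u × NbhdInterEq G x D v) →
                ∀ y → Adj G v y → y ≢ u → ∃ λ x → x ∈ D × x ≢ v × Adj G y x
        cover none y vy y≢u with y ∈? D
        ... | no y∉ = let x , x∈ , x≢v , xy = covered y (inj₂ vy)
                      in x , x∈ , x≢v , closed⇒adj y∉ x∈ xy
        -- For `y` in `D`, closed coverage may come from `y` itself; but since `y` is no witness for
        -- the second alternative, it has a neighbour in `D` other than `v`.
        ... | yes y∈ with only-or-other (sym G vy) v∈
        ...   | inj₁ onlyV = ⊥-elim (none (y , vy , y∈ , y≢u , onlyV))
        ...   | inj₂ other = other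

    costly⇒private : ∀ {u v D} → Adj G u v → Costly u v → IsγtSet (Adj G) D →
                     u ∈ D → v ∉ D → InPN G u D v
    costly⇒private {u} {v} {D} uv costly γ@(tds , _) u∈ v∉ = inj₂ uv , excl
      where
      excl : ∀ x → x ∈ D → x ≢ u → ¬ InClosedNbhd G x v
      excl x x∈ x≢u (inj₁ refl) = v∉ x∈
      excl x x∈ x≢u (inj₂ xv)   = <-irrefl refl (costly D γ outside D (dom , inj₁ u∈))
        where
        dom : ∀ i → SubDominated u v outside D i
        dom i with i ≟ v
        ... | yes refl = inj₁ (x , x∈ , sym G xv , x≢u' , x≢u ∘ proj₂)
          where
          x≢u' : ¬ (i ≡ u × x ≡ i)
          x≢u' (_ , refl) = v∉ x∈
        ... | no i≢v with tds i
        ...   | j , j∈ , e = inj₁ (j , j∈ , e , (λ { (_ , refl) → v∉ j∈ }) , i≢v ∘ proj₁)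

    costly⇒edgeCondition : ∀ {u v} → Adj G u v → Costly u v →
                           ∀ D → IsγtSet (Adj G) D → EdgeCondition G u v D
    costly⇒edgeCondition {u} {v} uv costly D γ@(tds , _) =
      (costly⇒private uv costly γ , costly⇒private (sym G uv) costly' γ) ,
      λ u∈ v∈ → either u∈ v∈ , costly⇒only-condition uv costly γ u∈ v∈ ,
                costly⇒only-condition (sym G uv) costly' γ v∈ u∈
      where
      costly' = costly-swap costly
      either : u ∈ D → v ∈ D → NbhdInterEq G u D v ⊎ NbhdInterEq G v D u
      either u∈ v∈ with only-or-other uv v∈ | only-or-other (sym G uv) u∈
      ... | inj₁ only | _         = inj₁ only
      ... | inj₂ _    | inj₁ only = inj₂ only
      -- Each endpoint has a dominator in `D` other than the opposite endpoint, so `D` again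
      -- survives without the new vertex.
      ... | inj₂ (x , x∈ , x≢v , ux) | inj₂ (y , y∈ , y≢u , vy) =
        ⊥-elim (<-irrefl refl (costly D γ outside D (dom , inj₁ u∈)))
        where
        dom : ∀ i → SubDominated u v outside D i
        dom i with i ≟ u | i ≟ v
        ... | yes refl | _        = inj₁ (x , x∈ , ux , x≢v ∘ proj₂ , adj⇒≢ uv ∘ proj₁)
        ... | no  _    | yes refl = inj₁ (y , y∈ , vy , adj⇒≢ uv ∘ ≡-sym ∘ proj₁ , y≢u ∘ proj₂)
        ... | no  i≢u  | no  i≢v with tds i
        ...   | j , j∈ , e = inj₁ (j , j∈ , e , i≢u ∘ proj₁ , i≢v ∘ proj₁)

    -- Assembling the equivalence.

    costly⇒sd≡1 : (∀ v → ∃ (Adj G v)) → ∀ {u v} → Adj G u v → Costly u v → SdγtEq G 1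
    costly⇒sd≡1 nbr {u} {v} uv costly = ordered (<-cmp (toℕ u) (toℕ v)) , minimal
      where
      single : ∀ {a b} → Adj G a b → toℕ a < toℕ b → Costly a b → _
      single {a} {b} ab a<b c =
        (a , b) ∷ [] , (((ab , a<b) ∷ []) , [] ∷ []) , refl , costly⇒increases adj? nbr c
      -- A valid edge set lists the smaller endpoint first; symmetry of `Costly` permits either
      -- orientation.
      ordered : _ → _
      ordered (tri< u<v _ _) = single uv u<v costly
      ordered (tri≈ _ eq _)  = ⊥-elim (adj⇒≢ uv (toℕ-injective eq))
      ordered (tri> _ _ v<u) = single (sym G uv) v<u (costly-swap costly)
      minimal : ∀ F → ValidEdgeSet G F → Increases G F → 1 ≤ length F
      minimal []      _ inc = ⊥-elim (¬increases-[] G inc)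
      minimal (_ ∷ _) _ _   = s≤s z≤n

theorem19 : ∀ (n : ℕ) (T : Graph n) → IsTree T → 3 ≤ n →
    (SdγtEq T 1 ⇔
    ((∃ λ w → IsLeaf T w × (∀ D → IsγtSet (Adj T) D → w ∉ D))
    ⊎ (∃ λ (u : Fin n) → ∃ λ (v : Fin n) → IsInnerEdge T u v ×
    (∀ D → IsγtSet (Adj T) D → EdgeCondition T u v D))))
theorem19 n T tree 3≤n = mk⇔ to from
  where
  adj? = tree-adj? T tree
  sd≡1 = costly⇒sd≡1 T adj? (neighbour T tree 3≤n)

  to : SdγtEq T 1 → _
  -- The single subdivided edge gives (i) if an endpoint is a leaf, whose unique neighbour is then
  -- the other endpoint, and (ii) otherwise.
  to (((a , b) ∷ [] , ((ab , _) ∷ [] , _) , refl , inc) , _) with leaf? T adj? a | leaf? T adj? b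
  ... | yes (x , ax , only) | _ =
    inj₁ (a , (x , ax , only) , costly⇒leaf-avoided T ab
      (λ w aw → trans (only w aw) (≡-sym (only b ab))) (increases⇒costly T inc))
  ... | no _ | yes (x , bx , only) =
    inj₁ (b , (x , bx , only) , costly⇒leaf-avoided T (sym T ab)
      (λ w bw → trans (only w bw) (≡-sym (only a (sym T ab))))
      (costly-swap T (increases⇒costly T inc)))
  ... | no ¬a | no ¬b =
    inj₂ (a , b , (ab , ¬a , ¬b) , costly⇒edgeCondition T adj? ab (increases⇒costly T inc))

  from : _ → SdγtEq T 1
  from (inj₁ (w , (u , wu , only) , avoid)) = sd≡1 wu (leaf-avoided⇒costly T wu only avoid)
  from (inj₂ (u , v , (uv , _) , cond))     = sd≡1 uv (edgeCondition⇒costly T uv cond)
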